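{- Let $N\ge 2$ and $1\le a,b\le N-1$ be integers with $\gcd(N,a,b)=1$, and let $k$ be the diameter of the three-quarters digraph $TQ(N,a,b)$. Then $$N\le \sum_{r=0}^{k}(1+3r)=\frac{1}{2}\left(3k^2+5k+2\right).$$
   Context: For integers $N\ge 2$ and $1\le a,b\le N-1$ with $\gcd(N,a,b)=1$, the three-quarters digraph $TQ(N,a,b)$ has vertex set $\mathbb{Z}_N$ (integers modulo $N$), and each vertex $i$ is joined by arcs to $i+a$ and $i+b$ (mod $N$); it is the circulant digraph with steps $a,b$, equipped with the following distance-like function. For $x,y\in\mathbb{Z}_N$, $d(x,y)$ is the minimum integer $\ell\ge 0$ such that there exist integers $m,n'\ge 0$ with $m+n'=\ell$ and $$y-x\equiv ma+n'b,\quad\text{or}\quad y-x\equiv -ma+n'b,\quad\text{or}\quad y-x\equiv ma-n'b \pmod N.$$ (The combination $-ma-n'b$ with both $m,n'>0$ is not allowed.) The function $d$ is translation invariant, $d(x,y)=d(0,y-x)$, but need not be symmetric. The diameter of $TQ(N,a,b)$ is $\max_{x,y\in\mathbb{Z}_N} d(x,y)=\max_{z\in\mathbb{Z}_N} d(0,z)$. -}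

module Defs where

open import Data.Nat as ℕ using (ℕ)
open import Data.Fin using (Fin; toℕ)
open import Data.Integer using (ℤ; +_; _+_; _-_; _*_; -_)
open import Data.Integer.Divisibility.Signed using (_∣_)
open import Data.Product using (∃-syntax; _×_)
open import Data.Sum using (_⊎_)
open import Relation.Binary.PropositionalEquality using (_≡_)

infix 4 _≡_[mod_]

_≡_[mod_] : ℤ → ℤ → ℕ → Set
x ≡ y [mod N ] = + N ∣ x - y

-- The vertex set ℤ_N of TQ(N,a,b) is Fin N, each class being represented by its
-- least nonnegative residue.

-- The displacement from x to y is realised by ℓ steps, using m times ±a and n times
-- ±b, where the two signs are not both negative.
Reaches : (N a b : ℕ) → Fin N → Fin N → ℕ → Set
Reaches N a b x y ℓ = ∃[ m ] ∃[ n ] m ℕ.+ n ≡ ℓ ×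
  ( (+ toℕ y - + toℕ x) ≡    + m * + a  + + n * + b [mod N ]
  ⊎ (+ toℕ y - + toℕ x) ≡ - (+ m * + a) + + n * + b [mod N ]
  ⊎ (+ toℕ y - + toℕ x) ≡    + m * + a  - + n * + b [mod N ] )

-- d(x,y) = ℓ.  When gcd(N,a,b) = 1 every y is reached from every x, so such an ℓ
-- exists; it is unique in any case.
IsDistance : (N a b : ℕ) → Fin N → Fin N → ℕ → Set
IsDistance N a b x y ℓ =
  Reaches N a b x y ℓ × (∀ ℓ′ → Reaches N a b x y ℓ′ → ℓ ℕ.≤ ℓ′)

-- k is the maximum of the values d(x,y).
IsDiameter : (N a b : ℕ) → ℕ → Set
IsDiameter N a b k =
  (∃[ x ] ∃[ y ] IsDistance N a b x y k) ×
  (∀ x y ℓ → IsDistance N a b x y ℓ → ℓ ℕ.≤ k)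

{-# OPTIONS --safe #-}

-- Exactly 1 + 3r combinations of a and b use r steps: r + 1 with both signs positive,
-- and r more for each of the two sign patterns with one negative sign.  By Bézout
-- every vertex is at some distance from a fixed vertex x, that distance is at most k,
-- and a displacement from x determines the vertex reached, so N is at most the number
-- of combinations using at most k steps.
module Submission where

open import Defs
open import Data.Nat using (ℕ; suc; _+_; _*_; _^_; _∸_; _≤_)
open import Data.Nat.GCD using (gcd)
open import Data.Integer using (+_)
open import Data.Rational using (_/_)
open import Data.List using (map; upTo)
open import Data.Nat.ListAction using (sum)
open import Data.Product using (_×_)
open import Relation.Binary.PropositionalEquality using (_≡_)

open import Data.Fin using (Fin; toℕ)
import Data.Fin.Properties as Fin
import Data.Integer as ℤ
open import Data.Integer using (ℤ)
open import Data.Integer.DivMod using (_%ℕ_; _/ℕ_; a≡a%ℕn+[a/ℕn]*n)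
open import Data.Integer.Divisibility.Signed
  using (divides; _∣?_; ∣m∣n⇒∣m-n; ∣⇒∣ᵤ)
  renaming (_∣_ to _∣ℤ_)
import Data.Integer.Properties as ℤ
import Data.Integer.Tactic.RingSolver as ℤ-Solver
open import Data.List using (List; []; _∷_; _++_; _∷ʳ_; length; lookup; applyUpTo; concatMap)
import Data.List.Properties as List
open import Data.List.Relation.Unary.Any using (Any; any?; index)
import Data.List.Relation.Unary.Any.Properties as Any
open import Data.Nat using (zero; _<_; s≤s; NonZero)
open import Data.Nat.Divisibility using (_∣_; >⇒∤)
open import Data.Nat.GCD using (module Bézout; gcd-GCD)
open import Data.Nat.Induction using (<-rec)
open import Data.Nat.ListAction.Properties using (sum-++)
open import Data.Nat.Properties
import Data.Nat.Tactic.RingSolver as ℕ-Solver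
open import Data.Product using (∃-syntax; _,_)
open import Data.Rational.Properties using (fromℚᵘ-cong)
open import Data.Rational.Unnormalised using (mkℚᵘ; *≡*)
open import Data.Sum using (inj₁; inj₂)
open import Level using (Level)
open import Relation.Binary.PropositionalEquality
  using (refl; sym; trans; cong; cong₂; subst; module ≡-Reasoning)
open import Relation.Nullary using (yes; no; contradiction)
open import Relation.Nullary.Decidable using (map′)
open import Relation.Unary using (Pred; Decidable)

private
  variable
    ℓ : Level
    A B : Set ℓ

-- Strong induction on the witness: a bounded search below `n` either finds a smaller witness, to
-- which the induction hypothesis applies, or shows that `n` is least.
minimal : {P : Pred ℕ ℓ} → Decidable P → ∀ {n} → P n →
          ∃[ m ] P m × (∀ i → P i → m ≤ i)
minimal {P = P} P? {n} = <-rec (λ n → P n → ∃[ m ] P m × (∀ i → P i → m ≤ i)) step n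
  where
  step : ∀ n → (∀ {i} → i < n → P i → ∃[ m ] P m × (∀ i → P i → m ≤ i)) →
         P n → ∃[ m ] P m × (∀ i → P i → m ≤ i)
  step n rec pn with anyUpTo? P? n
  ... | yes (i , i<n , pi) = rec i<n pi
  ... | no none            = n , pn , λ i pi → ≮⇒≥ λ i<n → none (i , i<n , pi)

length-concatMap : (f : A → List B) (xs : List A) →
                   length (concatMap f xs) ≡ sum (map (λ x → length (f x)) xs)
length-concatMap f []       = refl
length-concatMap f (x ∷ xs) =
  trans (List.length-++ (f x)) (cong (λ n → length (f x) + n) (length-concatMap f xs))

-- Bézout's identity over `ℕ` avoids subtraction by keeping one product on the side of the gcd; this
-- moves that product across, in `ℤ`.
subtract-product : ∀ d x m y n → d + x * m ≡ y * n →
          + d ≡ (ℤ.- + x) ℤ.* + m ℤ.+ + y ℤ.* + n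
subtract-product d x m y n eq = begin
  + d                                          ≡⟨ cancel (+ d) (+ x) (+ m) ⟩
  (ℤ.- + x) ℤ.* + m ℤ.+ (+ d ℤ.+ + x ℤ.* + m)  ≡⟨ cong shift (ℤ.pos-* x m) ⟨
  (ℤ.- + x) ℤ.* + m ℤ.+ + (d + x * m)          ≡⟨ cong (λ i → (ℤ.- + x) ℤ.* + m ℤ.+ + i) eq ⟩
  (ℤ.- + x) ℤ.* + m ℤ.+ + (y * n)              ≡⟨ cong (λ i → (ℤ.- + x) ℤ.* + m ℤ.+ i) (ℤ.pos-* y n) ⟩
  (ℤ.- + x) ℤ.* + m ℤ.+ + y ℤ.* + n            ∎
  where
  open ≡-Reasoning
  shift : ℤ → ℤ
  shift i = (ℤ.- + x) ℤ.* + m ℤ.+ (+ d ℤ.+ i)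
  cancel : ∀ d x m → d ≡ (ℤ.- x) ℤ.* m ℤ.+ (d ℤ.+ x ℤ.* m)
  cancel = ℤ-Solver.solve-∀

ℤ-bézout : ∀ m n → ∃[ u ] ∃[ v ] + gcd m n ≡ u ℤ.* + m ℤ.+ v ℤ.* + n
ℤ-bézout m n with Bézout.identity (gcd-GCD m n)
... | Bézout.+- x y eq = + x , ℤ.- + y ,
  trans (subtract-product (gcd m n) y n x m eq) (ℤ.+-comm _ (+ x ℤ.* + m))
... | Bézout.-+ x y eq = ℤ.- + x , + y , subtract-product (gcd m n) x m y n eq

-- Reducing the Bézout coefficients modulo N makes them nonnegative.
positive-combination : ∀ N a b .{{_ : NonZero N}} → gcd N (gcd a b) ≡ 1 → ∀ δ →
                       ∃[ m ] ∃[ n ] δ ≡ + m ℤ.* + a ℤ.+ + n ℤ.* + b [mod N ]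
positive-combination N a b coprime δ
  with u , v , eq₁ ← ℤ-bézout N (gcd a b)
  with s , t , eq₂ ← ℤ-bézout a b =
  c %ℕ N , d %ℕ N ,
  divides (δ ℤ.* u ℤ.+ (c /ℕ N) ℤ.* + a ℤ.+ (d /ℕ N) ℤ.* + b)
    (collect (+ N) (+ a) (+ b) u v s t δ (+ (c %ℕ N)) (+ (d %ℕ N)) (c /ℕ N) (d /ℕ N)
      one (a≡a%ℕn+[a/ℕn]*n c N) (a≡a%ℕn+[a/ℕn]*n d N))
  where
  -- Multiplying 1 = uN + v(sa + tb) by δ makes `c` and `d` the coefficients of `a` and `b`. The
  -- multiple of `N` left over, together with the quotients of `c` and `d` by `N`, gives the witness
  -- of divisibility.
  c = δ ℤ.* v ℤ.* s
  d = δ ℤ.* v ℤ.* t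

  one : ℤ.1ℤ ≡ u ℤ.* + N ℤ.+ v ℤ.* (s ℤ.* + a ℤ.+ t ℤ.* + b)
  one = trans (cong +_ (sym coprime)) (trans eq₁ (cong (λ g → u ℤ.* + N ℤ.+ v ℤ.* g) eq₂))

  expand : ∀ N a b u v s t δ →
    δ ℤ.* (u ℤ.* N ℤ.+ v ℤ.* (s ℤ.* a ℤ.+ t ℤ.* b)) ≡
    δ ℤ.* u ℤ.* N ℤ.+ (δ ℤ.* v ℤ.* s ℤ.* a ℤ.+ δ ℤ.* v ℤ.* t ℤ.* b)
  expand = ℤ-Solver.solve-∀

  regroup : ∀ N a b e m n q₁ q₂ →
    e ℤ.* N ℤ.+ ((m ℤ.+ q₁ ℤ.* N) ℤ.* a ℤ.+ (n ℤ.+ q₂ ℤ.* N) ℤ.* b) ℤ.- (m ℤ.* a ℤ.+ n ℤ.* b) ≡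
    (e ℤ.+ q₁ ℤ.* a ℤ.+ q₂ ℤ.* b) ℤ.* N
  regroup = ℤ-Solver.solve-∀

  collect : ∀ N a b u v s t δ m n q₁ q₂ →
    ℤ.1ℤ ≡ u ℤ.* N ℤ.+ v ℤ.* (s ℤ.* a ℤ.+ t ℤ.* b) →
    δ ℤ.* v ℤ.* s ≡ m ℤ.+ q₁ ℤ.* N → δ ℤ.* v ℤ.* t ≡ n ℤ.+ q₂ ℤ.* N →
    δ ℤ.- (m ℤ.* a ℤ.+ n ℤ.* b) ≡ (δ ℤ.* u ℤ.+ q₁ ℤ.* a ℤ.+ q₂ ℤ.* b) ℤ.* N
  collect N a b u v s t δ m n q₁ q₂ one eq-m eq-n = begin
    δ ℤ.- w
      ≡⟨ cong (ℤ._- w) (ℤ.*-identityʳ δ) ⟨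
    δ ℤ.* ℤ.1ℤ ℤ.- w
      ≡⟨ cong (λ i → δ ℤ.* i ℤ.- w) one ⟩
    δ ℤ.* (u ℤ.* N ℤ.+ v ℤ.* (s ℤ.* a ℤ.+ t ℤ.* b)) ℤ.- w
      ≡⟨ cong (ℤ._- w) (expand N a b u v s t δ) ⟩
    δ ℤ.* u ℤ.* N ℤ.+ (δ ℤ.* v ℤ.* s ℤ.* a ℤ.+ δ ℤ.* v ℤ.* t ℤ.* b) ℤ.- w
      ≡⟨ cong₂ (λ i j → δ ℤ.* u ℤ.* N ℤ.+ (i ℤ.* a ℤ.+ j ℤ.* b) ℤ.- w) eq-m eq-n ⟩
    δ ℤ.* u ℤ.* N ℤ.+ ((m ℤ.+ q₁ ℤ.* N) ℤ.* a ℤ.+ (n ℤ.+ q₂ ℤ.* N) ℤ.* b) ℤ.- w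
      ≡⟨ regroup N a b (δ ℤ.* u) m n q₁ q₂ ⟩
    (δ ℤ.* u ℤ.+ q₁ ℤ.* a ℤ.+ q₂ ℤ.* b) ℤ.* N ∎
    where
    open ≡-Reasoning
    w = m ℤ.* a ℤ.+ n ℤ.* b

-- Two numbers below `N` differ by less than `N` in absolute value, and the only multiple of `N`
-- that small is 0.
residue-unique : ∀ {N} (y z : Fin N) → + toℕ y ≡ + toℕ z [mod N ] → y ≡ z
residue-unique {N} y z y≡z =
  Fin.toℕ-injective (ℤ.+-injective (ℤ.i-j≡0⇒i≡j _ _ (ℤ.∣i∣≡0⇒i≡0 (small (∣⇒∣ᵤ y≡z) bound))))
  where
  bound : ℤ.∣ + toℕ y ℤ.- + toℕ z ∣ < N
  bound rewrite ℤ.m-n≡m⊖n (toℕ y) (toℕ z) =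
    ≤-<-trans (ℤ.∣m⊝n∣≤m⊔n (toℕ y) (toℕ z)) (⊔-pres-<m (Fin.toℕ<n y) (Fin.toℕ<n z))
  small : ∀ {d} → N ∣ d → d < N → d ≡ 0
  small {zero}  _   _   = refl
  small {suc _} N∣d d<N = contradiction N∣d (>⇒∤ d<N)

module _ (N a b : ℕ) where

  -- In the mixed forms the index i stands for 1 + i negative steps: with no negative
  -- step the combination is already counted as positive.
  positive mixedᵃ mixedᵇ : ℕ → ℕ → ℤ
  positive r m = + m ℤ.* + a ℤ.+ + (r ∸ m) ℤ.* + b
  mixedᵃ   r i = ℤ.- (+ suc i ℤ.* + a) ℤ.+ + (r ∸ suc i) ℤ.* + b
  mixedᵇ   r i = + (r ∸ suc i) ℤ.* + a ℤ.- + suc i ℤ.* + b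

  combinations : ℕ → List ℤ
  combinations r =
    applyUpTo (positive r) (suc r) ++ applyUpTo (mixedᵃ r) r ++ applyUpTo (mixedᵇ r) r

  length-combinations : ∀ r → length (combinations r) ≡ 1 + 3 * r
  length-combinations r = begin
    length (combinations r)  ≡⟨ List.length-++ (applyUpTo (positive r) (suc r)) ⟩
    _                        ≡⟨ cong₂ _+_ (List.length-applyUpTo (positive r) (suc r))
                                  (trans (List.length-++ (applyUpTo (mixedᵃ r) r))
                                    (cong₂ _+_ (List.length-applyUpTo (mixedᵃ r) r)
                                               (List.length-applyUpTo (mixedᵇ r) r))) ⟩
    suc r + (r + r)          ≡⟨ regroup r ⟩
    1 + 3 * r                ∎
    where
    open ≡-Reasoning
    regroup : ∀ r → suc r + (r + r) ≡ 1 + 3 * r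
    regroup = ℕ-Solver.solve-∀

  module _ (x y : Fin N) where

    Realises : ℤ → Set
    Realises w = (+ toℕ y ℤ.- + toℕ x) ≡ w [mod N ]

    Reaches⇒Any : ∀ {r} → Reaches N a b x y r → Any Realises (combinations r)
    Reaches⇒Any (m , n , refl , inj₁ p) =
      Any.++⁺ˡ (Any.applyUpTo⁺ (positive (m + n)) p′ (s≤s (m≤m+n m n)))
      where
      p′ : Realises (positive (m + n) m)
      p′ rewrite m+n∸m≡n m n = p
    -- A mixed form with no negative step computes to the positive form, so it is looked up there;
    -- likewise for `b` below.
    Reaches⇒Any (zero , n , refl , inj₂ (inj₁ p)) =
      Reaches⇒Any (zero , n , refl , inj₁ p)
    Reaches⇒Any (suc i , n , refl , inj₂ (inj₁ p)) =
      Any.++⁺ʳ (applyUpTo (positive r) (suc r))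
        (Any.++⁺ˡ (Any.applyUpTo⁺ (mixedᵃ r) p′ (m≤m+n (suc i) n)))
      where
      r = suc i + n
      p′ : Realises (mixedᵃ r i)
      p′ rewrite m+n∸m≡n i n = p
    Reaches⇒Any (m , zero , refl , inj₂ (inj₂ p)) =
      Reaches⇒Any (m , zero , refl , inj₁ p)
    Reaches⇒Any (m , suc i , refl , inj₂ (inj₂ p)) =
      Any.++⁺ʳ (applyUpTo (positive r) (suc r))
        (Any.++⁺ʳ (applyUpTo (mixedᵃ r) r)
          (Any.applyUpTo⁺ (mixedᵇ r) p′ (m≤n+m (suc i) m)))
      where
      r = m + suc i
      p′ : Realises (mixedᵇ r i)
      p′ rewrite m+n∸n≡m m (suc i) = p

    Any⇒Reaches : ∀ {r} → Any Realises (combinations r) → Reaches N a b x y r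
    Any⇒Reaches {r} any with Any.++⁻ (applyUpTo (positive r) (suc r)) any
    ... | inj₁ any₁ with m , s≤s m≤r , p ← Any.applyUpTo⁻ (positive r) any₁ =
      m , r ∸ m , m+[n∸m]≡n m≤r , inj₁ p
    ... | inj₂ any₂₃ with Any.++⁻ (applyUpTo (mixedᵃ r) r) any₂₃
    ...   | inj₁ any₂ with i , i<r , p ← Any.applyUpTo⁻ (mixedᵃ r) any₂ =
      suc i , r ∸ suc i , m+[n∸m]≡n i<r , inj₂ (inj₁ p)
    ...   | inj₂ any₃ with i , i<r , p ← Any.applyUpTo⁻ (mixedᵇ r) any₃ =
      r ∸ suc i , suc i , m∸n+n≡m i<r , inj₂ (inj₂ p)

    -- Searching the finite list replaces the quantifiers over `m` and `n`. This decidability is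
    -- what lets `minimal` extract a distance.
    reaches? : Decidable (Reaches N a b x y)
    reaches? r = map′ Any⇒Reaches Reaches⇒Any (any? (λ w → + N ∣? _) (combinations r))

    reachable : gcd N (gcd a b) ≡ 1 → ∃[ r ] Reaches N a b x y r
    reachable coprime =
      -- `N` is nonzero because `Fin N` has the element `x`.
      let m , n , p = positive-combination N a b {{Fin.nonZeroIndex x}} coprime
                        (+ toℕ y ℤ.- + toℕ x)
      in m + n , m , n , refl , inj₁ p

    distance : gcd N (gcd a b) ≡ 1 → ∃[ r ] IsDistance N a b x y r
    distance coprime = let _ , reaches = reachable coprime in minimal reaches? reaches

  -- Subtracting the two congruences cancels both `x` and `w`, leaving `y` and `z` congruent modulo
  -- `N`.
  displacement-injective : ∀ x y z {w} → Realises x y w → Realises x z w → y ≡ z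
  displacement-injective x y z {w} p q =
    residue-unique y z (subst (+ N ∣ℤ_) (cancel (+ toℕ x) (+ toℕ y) (+ toℕ z) w) (∣m∣n⇒∣m-n p q))
    where
    cancel : ∀ x y z w → (y ℤ.- x ℤ.- w) ℤ.- (z ℤ.- x ℤ.- w) ≡ y ℤ.- z
    cancel = ℤ-Solver.solve-∀

  ball : ℕ → List ℤ
  ball k = concatMap combinations (upTo (suc k))

  length-ball : ∀ k → length (ball k) ≡ sum (map (λ r → 1 + 3 * r) (upTo (suc k)))
  length-ball k = trans (length-concatMap combinations (upTo (suc k)))
                        (cong sum (List.map-cong length-combinations (upTo (suc k))))

  -- Pigeonhole: each vertex is sent to a position in the list whose entry realises it. Counting
  -- positions instead of values makes repeated entries harmless.
  ball-covers⇒N≤length : ∀ k x → (∀ y → Any (Realises x y) (ball k)) → N ≤ length (ball k)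
  ball-covers⇒N≤length k x covered = Fin.injective⇒≤ {f = λ y → index (covered y)} injective
    where
    injective : ∀ {y z} → index (covered y) ≡ index (covered z) → y ≡ z
    injective {y} {z} eq = displacement-injective x y z (Any.lookup-index (covered y))
      (subst (λ i → Realises x z (lookup (ball k) i)) (sym eq) (Any.lookup-index (covered z)))

  diameter⇒ball-covers : ∀ {k} → gcd N (gcd a b) ≡ 1 → IsDiameter N a b k →
                         ∀ x y → Any (Realises x y) (ball k)
  diameter⇒ball-covers coprime (_ , bounded) x y =
    let r , dist@(reaches , _) = distance x y coprime in
    Any.concatMap⁺ combinations
      -- The distance `r` is at most `k`, so it occurs in `upTo (suc k)`, which ends at `k`.
      (Any.applyUpTo⁺ (λ i → i) (Reaches⇒Any x y reaches) (s≤s (bounded x y r dist)))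

-- Doubling keeps the closed form inside `ℕ`. The induction splits off the last term, so the list is
-- first rewritten with that term at its end.
double-sum : ∀ k → sum (map (λ r → 1 + 3 * r) (upTo (suc k))) * 2 ≡ 3 * k ^ 2 + 5 * k + 2
double-sum zero    = refl
double-sum (suc k) = begin
  S (upTo (suc (suc k))) * 2                   ≡⟨ cong (λ rs → S rs * 2) (List.upTo-∷ʳ (suc k)) ⟨
  S (upTo (suc k) ∷ʳ suc k) * 2                ≡⟨ cong (λ rs → sum rs * 2) (List.map-++ f (upTo (suc k)) _) ⟩
  sum (map f (upTo (suc k)) ∷ʳ f (suc k)) * 2  ≡⟨ cong (_* 2) (sum-++ (map f (upTo (suc k))) _) ⟩
  (S (upTo (suc k)) + (f (suc k) + 0)) * 2     ≡⟨ *-distribʳ-+ 2 (S (upTo (suc k))) _ ⟩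
  S (upTo (suc k)) * 2 + (f (suc k) + 0) * 2   ≡⟨ cong (_+ (f (suc k) + 0) * 2) (double-sum k) ⟩
  3 * k ^ 2 + 5 * k + 2 + (f (suc k) + 0) * 2  ≡⟨ step k ⟩
  3 * suc k ^ 2 + 5 * suc k + 2                ∎
  where
  open ≡-Reasoning
  f : ℕ → ℕ
  f r = 1 + 3 * r
  S : List ℕ → ℕ
  S rs = sum (map f rs)
  -- The squares are written as `_^_` unfolds them, and the `+ 0` comes from the sum of a
  -- one-element list.
  step : ∀ k → 3 * (k * (k * 1)) + 5 * k + 2 + (1 + 3 * (1 + k) + 0) * 2 ≡
               3 * ((1 + k) * ((1 + k) * 1)) + 5 * (1 + k) + 2
  step = ℕ-Solver.solve-∀

-- Cross-multiplication on unnormalised fractions avoids reasoning about reduction to lowest terms.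
-- `mkℚᵘ` takes the denominator minus one, hence the 0 and 1.
s*2≡t⇒s/1≡t/2 : ∀ s t → s * 2 ≡ t → + s / 1 ≡ + t / 2
s*2≡t⇒s/1≡t/2 s t eq = fromℚᵘ-cong {mkℚᵘ (+ s) 0} {mkℚᵘ (+ t) 1} (*≡* (begin
  + s ℤ.* + 2  ≡⟨ ℤ.pos-* s 2 ⟨
  + (s * 2)    ≡⟨ cong +_ eq ⟩
  + t          ≡⟨ ℤ.*-identityʳ (+ t) ⟨
  + t ℤ.* + 1  ∎))
  where open ≡-Reasoning

mainTheorem3 : ∀ (N a b k : ℕ) →
    2 ≤ N → 1 ≤ a → a ≤ N ∸ 1 → 1 ≤ b → b ≤ N ∸ 1 →
    gcd N (gcd a b) ≡ 1 →
    IsDiameter N a b k →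
    (N ≤ sum (map (λ r → 1 + 3 * r) (upTo (suc k)))) ×
    (+ sum (map (λ r → 1 + 3 * r) (upTo (suc k))) / 1 ≡ + (3 * k ^ 2 + 5 * k + 2) / 2)
-- The source of a pair at distance `k` serves as the fixed vertex.
mainTheorem3 N a b k _ _ _ _ _ coprime diam@((x , _) , _) =
  subst (N ≤_) (length-ball N a b k)
    (ball-covers⇒N≤length N a b k x (diameter⇒ball-covers N a b coprime diam x)) ,
  s*2≡t⇒s/1≡t/2 (sum (map (λ r → 1 + 3 * r) (upTo (suc k)))) (3 * k ^ 2 + 5 * k + 2) (double-sum k)
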